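{- For each integer $n\ge 0$, let $a_n$ denote the number of tilings of a $6\times 4n$ board by $L$-tetrominoes (rotations allowed, reflections not allowed). Then the generating function is $\sum_{n\ge 0}a_nt^n=-A(t)/B(t)$, where \[ A(t)=(t -1)^{2} (t^{9}-17 t^{8}+114 t^{7}-386 t^{6}+714 t^{5}-732 t^{4}+412 t^{3}-123 t^{2}+18 t -1), \] and \begin{align*} B(t)&=t^{12}-24 t^{11}+239 t^{10}-1280 t^{9}+4051 t^{8}-7944 t^{7}+9918 t^{6}-8001 t^{5}\\ &\qquad +4138 t^{4}-1330 t^{3}+251 t^{2}-25 t +1. \end{align*} The first terms of the sequence $(a_n)_{n\ge 0}$ are $1, 5, 34, 249, 1882, 14492, 113029, 889719, 7050677, \ldots$
   Context: A $k\times n$ board is the rectangle of unit cells $\{(x,y)\in\mathbb{Z}^2: 0\le x<n,\ 0\le y<k\}$, where each cell is named by its bottom left corner. The $L$-tetromino tiles are the translates of the four sets (the rotations of the $L$-tetromino) \[\{(0,0),(0,1),(0,2),(1,0)\},\ \{(0,0),(0,1),(1,1),(2,1)\},\ \{(0,0),(1,0),(2,0),(2,1)\},\ \{(0,2),(1,0),(1,1),(1,2)\}.\] Reflections of these shapes are not allowed. A tiling of a board is a partition of its set of cells into such tiles (each tile may be used any number of times); two tilings are the same only if they are equal as partitions of the board (no identification under symmetries). The empty board ($n=0$) has exactly one tiling. Generating functions are formal power series in $t$ with rational coefficients. -}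

module Defs where

open import Data.Fin.Base using (Fin)
open import Data.Integer.Base as ℤ using (ℤ; +_)
open import Data.List.Base using (List; []; _∷_; map)
open import Data.List.Membership.Propositional renaming (_∈_ to _∈ₗ_) using ()
open import Data.Nat.Base using (ℕ; zero; suc)
open import Data.Product using (_×_; _,_; ∃!)
open import Data.Rational.Base as ℚ using (ℚ; 0ℚ)
import Data.Rational.Properties as ℚ
open import Function.Base using (_∘_)
open import Function.Bundles using (Inverse)
open import Level using (0ℓ) renaming (suc to lsuc)
open import Relation.Binary.Bundles using (Setoid)
import Relation.Binary.Construct.On as On
open import Relation.Binary.PropositionalEquality
  using (_≡_; _≗_; trans; cong; setoid; module ≡-Reasoning)
open import Relation.Unary using (Pred; _∈_)
open import Relation.Unary.Relation.Binary.Equality using (≐-setoid)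

Cell : Set
Cell = ℤ × ℤ

-- k rows and n columns.
Board : (k n : ℕ) → Pred Cell 0ℓ
Board k n (x , y) =
  (+ 0 ℤ.≤ x × x ℤ.< + n) × (+ 0 ℤ.≤ y × y ℤ.< + k)

data Shape : Set where
  L₁ L₂ L₃ L₄ : Shape

footprint : Shape → List Cell
footprint L₁ = (+ 0 , + 0) ∷ (+ 0 , + 1) ∷ (+ 0 , + 2) ∷ (+ 1 , + 0) ∷ []
footprint L₂ = (+ 0 , + 0) ∷ (+ 0 , + 1) ∷ (+ 1 , + 1) ∷ (+ 2 , + 1) ∷ []
footprint L₃ = (+ 0 , + 0) ∷ (+ 1 , + 0) ∷ (+ 2 , + 0) ∷ (+ 2 , + 1) ∷ []
footprint L₄ = (+ 0 , + 2) ∷ (+ 1 , + 0) ∷ (+ 1 , + 1) ∷ (+ 1 , + 2) ∷ []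

-- A tile is the translate of a footprint by a vector.  No two of the four
-- footprints are translates of each other, so distinct elements of Tile
-- have distinct sets of cells, and a set of tiles is the same thing as the
-- set of their cell sets.
record Tile : Set where
  constructor _at_
  field
    shape  : Shape
    offset : Cell

translate : Cell → Cell → Cell
translate (u , v) (x , y) = u ℤ.+ x , v ℤ.+ y

cells : Tile → List Cell
cells (s at v) = map (translate v) (footprint s)

record Tiling (k n : ℕ) : Set₁ where
  field
    tiles     : Pred Tile 0ℓ
    inside    : ∀ {t c} → t ∈ tiles → c ∈ₗ cells t → c ∈ Board k n
    partition : ∀ {c} → c ∈ Board k n →
                ∃! _≡_ λ t → t ∈ tiles × c ∈ₗ cells t

-- Tilings are equal when they consist of the same tiles.
tilings : (k n : ℕ) → Setoid (lsuc 0ℓ) 0ℓ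
tilings k n = On.setoid (≐-setoid Tile 0ℓ) (Tiling.tiles {k} {n})

HasCardinality : ∀ {c ℓ} → Setoid c ℓ → ℕ → Set _
HasCardinality S m = Inverse (setoid (Fin m)) S

-- Formal power series as coefficient sequences; equality is _≗_.
Series : Set
Series = ℕ → ℚ

infixl 7 _⊛_ _⊘_
infixl 6 _⊖_
infix  8 ⊝_
infixr 9 _⊛^_

-- (P − P 0) / t.
tail : Series → Series
tail P = P ∘ suc

⊝_ : Series → Series
(⊝ P) n = ℚ.- P n

_⊖_ : Series → Series → Series
(P ⊖ Q) n = P n ℚ.- Q n

scale : ℚ → Series → Series
scale r P n = r ℚ.* P n

-- Cauchy product, along P = P 0 + t · tail P.
_⊛_ : Series → Series → Series
(P ⊛ Q) zero    = P 0 ℚ.* Q 0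
(P ⊛ Q) (suc n) = P 0 ℚ.* Q (suc n) ℚ.+ (tail P ⊛ Q) n

-- A polynomial from its integer coefficients, constant term first.
poly : List ℤ → Series
poly []       _       = 0ℚ
poly (c ∷ cs) zero    = c ℚ./ 1
poly (c ∷ cs) (suc n) = poly cs n

_⊛^_ : Series → ℕ → Series
P ⊛^ zero  = poly (+ 1 ∷ [])
P ⊛^ suc m = P ⊛ (P ⊛^ m)

-- The quotient by a series with invertible constant term, computed by long
-- division; see ⊘-⊛.
_⊘_ : (P Q : Series) .{{_ : ℚ.NonZero (Q 0)}} → Series
(P ⊘ Q) zero    = P 0 ℚ.÷ Q 0
(P ⊘ Q) (suc n) = (tail (P ⊖ scale (P 0 ℚ.÷ Q 0) Q) ⊘ Q) n

÷-* : ∀ p q .{{_ : ℚ.NonZero q}} → (p ℚ.÷ q) ℚ.* q ≡ p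
÷-* p q = trans (ℚ.*-assoc p (ℚ.1/ q) q)
         (trans (cong (p ℚ.*_) (ℚ.*-inverseˡ q)) (ℚ.*-identityʳ p))

⊘-⊛ : ∀ P Q .{{_ : ℚ.NonZero (Q 0)}} → (P ⊘ Q) ⊛ Q ≗ P
⊘-⊛ P Q zero    = ÷-* (P 0) (Q 0)
⊘-⊛ P Q (suc n) = begin
  r ℚ.+ ((P′ ⊘ Q) ⊛ Q) n            ≡⟨ cong (r ℚ.+_) (⊘-⊛ P′ Q n) ⟩
  r ℚ.+ (P (suc n) ℚ.- r)           ≡⟨ ℚ.+-comm r _ ⟩
  (P (suc n) ℚ.- r) ℚ.+ r           ≡⟨ ℚ.+-assoc (P (suc n)) (ℚ.- r) r ⟩
  P (suc n) ℚ.+ (ℚ.- r ℚ.+ r)       ≡⟨ cong (P (suc n) ℚ.+_) (ℚ.+-inverseˡ r) ⟩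
  P (suc n) ℚ.+ 0ℚ                  ≡⟨ ℚ.+-identityʳ _ ⟩
  P (suc n)                         ∎
  where
  open ≡-Reasoning
  q₀ = P 0 ℚ.÷ Q 0
  r  = q₀ ℚ.* Q (suc n)
  P′ = tail (P ⊖ scale q₀ Q)

generatingFunction : (ℕ → ℕ) → Series
generatingFunction a n = + a n ℚ./ 1

A : Series
A = poly (ℤ.- + 1 ∷ + 1 ∷ []) ⊛^ 2 ⊛
    poly ( ℤ.- + 1 ∷ + 18 ∷ ℤ.- + 123 ∷ + 412 ∷ ℤ.- + 732 ∷ + 714
         ∷ ℤ.- + 386 ∷ + 114 ∷ ℤ.- + 17 ∷ + 1 ∷ [])

B : Series
B = poly ( + 1 ∷ ℤ.- + 25 ∷ + 251 ∷ ℤ.- + 1330 ∷ + 4138 ∷ ℤ.- + 8001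
         ∷ + 9918 ∷ ℤ.- + 7944 ∷ + 4051 ∷ ℤ.- + 1280 ∷ + 239
         ∷ ℤ.- + 24 ∷ + 1 ∷ [])

{-# OPTIONS --safe #-}

-- Scan the cells of the board column by column, each column from bottom to
-- top.  The first uncovered cell must be the first cell (the anchor) of the
-- tile covering it, so at most four tiles can go there, and how the rest of
-- the board can be tiled depends only on the current row and on which of the
-- next 13 cells are already covered.  At multiples of four columns only 26
-- such masks occur.  The vector of their tiling numbers is multiplied by a
-- fixed matrix when four columns are added; hence a linear recurrence with
-- the coefficients of B that holds once for all 26 masks holds forever.

module Submission where

open import Defs
open import Algebra.Bundles using (module CommutativeMonoid)
open import Data.Bool.Base using (Bool; true; false; T; not; _∧_; if_then_else_)
open import Data.Bool.ListAction using (any; or)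
import Data.Bool.Properties as Bool
open import Data.Empty using (⊥-elim)
open import Data.Fin.Base using (Fin; zero; suc; toℕ; fromℕ<)
open import Data.Fin.Patterns
import Data.Fin.Properties as Fin
open import Data.Integer.Base as ℤ using (ℤ; +_; -[1+_]; +≤+; +<+)
import Data.Integer.Properties as ℤ
open import Data.List.Base
  using (List; []; _∷_; _++_; map; concatMap; deduplicate; drop; foldr; length; lookup; mapMaybe; upTo)
open import Data.List.Membership.Propositional using (find; lose) renaming (_∈_ to _∈ₗ_)
open import Data.List.Membership.Propositional.Properties using (∈-lookup; ∈-map⁺; ∈-map⁻)
import Data.List.Properties as List
open import Data.List.Relation.Unary.All as All using (All; []; _∷_)
import Data.List.Relation.Unary.All.Properties as All
open import Data.List.Relation.Unary.AllPairs using (AllPairs; []; _∷_)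
import Data.List.Relation.Unary.AllPairs.Properties as AllPairs
open import Data.List.Relation.Unary.Any as Any using (Any; here; there)
import Data.List.Relation.Unary.Any.Properties as Any
open import Data.Maybe.Base using (Maybe; just; nothing; maybe)
open import Data.Nat.Base using (ℕ; zero; suc; _+_; _*_; _∸_; _≤_; _<_; z≤n; s≤s; z<s; s<s; s<s⁻¹)
open import Data.Nat.Coprimality as Coprime using (1-coprimeTo)
open import Data.Nat.DivMod using (_mod_)
open import Data.Nat.ListAction using (sum)
open import Data.Nat.ListAction.Properties using (sum-++)
open import Data.Nat.Properties as ℕ using (_<?_)
open import Data.Product using (_×_; _,_; proj₁; proj₂; ∃; ∃!; Σ-syntax)
open import Data.Product.Properties using (≡-dec; ,-injectiveˡ; ,-injectiveʳ)
open import Data.Rational.Base as ℚ using (ℚ; mkℚ)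
import Data.Rational.Properties as ℚ
open import Data.Sum.Base as Sum using (_⊎_; inj₁; inj₂)
open import Data.Vec.Base as Vec using (Vec; []; _∷_)
import Data.Vec.Properties as Vec
open import Function.Base using (_∘_; id)
open import Level using (0ℓ)
open import Relation.Binary.Core using (Rel)
open import Relation.Binary.Definitions using (DecidableEquality; Symmetric)
open import Relation.Binary.PropositionalEquality
open import Relation.Nullary using (¬_; yes; no)
open import Relation.Nullary.Decidable using (from-yes; map′; _×-dec_)
open import Relation.Unary using (Pred; _≐_)
open import Relation.Unary.Properties using (≐-refl; ≐-sym; ≐-trans)

open import Algebra.Properties.AbelianGroup ℤ.+-0-abelianGroup
  using (//-rightDividesˡ; //-rightDividesʳ; \\-leftDividesʳ)
open import Algebra.Properties.CommutativeSemigroup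
  (CommutativeMonoid.commutativeSemigroup ℤ.+-0-commutativeMonoid)
  using (interchange)
import Algebra.Properties.AbelianGroup ℚ.+-0-abelianGroup as ℚ-group

-- Decidable equality of shapes, cells and tiles

_≟ˢ_ : DecidableEquality Shape
L₁ ≟ˢ L₁ = yes refl
L₁ ≟ˢ L₂ = no λ ()
L₁ ≟ˢ L₃ = no λ ()
L₁ ≟ˢ L₄ = no λ ()
L₂ ≟ˢ L₁ = no λ ()
L₂ ≟ˢ L₂ = yes refl
L₂ ≟ˢ L₃ = no λ ()
L₂ ≟ˢ L₄ = no λ ()
L₃ ≟ˢ L₁ = no λ ()
L₃ ≟ˢ L₂ = no λ ()
L₃ ≟ˢ L₃ = yes refl
L₃ ≟ˢ L₄ = no λ ()
L₄ ≟ˢ L₁ = no λ ()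
L₄ ≟ˢ L₂ = no λ ()
L₄ ≟ˢ L₃ = no λ ()
L₄ ≟ˢ L₄ = yes refl

_≟ᶜ_ : DecidableEquality Cell
_≟ᶜ_ = ≡-dec ℤ._≟_ ℤ._≟_

_≟ᵗ_ : DecidableEquality Tile
(s at u) ≟ᵗ (s′ at u′) =
  map′ (λ { (refl , refl) → refl }) (λ { refl → refl , refl }) ((s ≟ˢ s′) ×-dec (u ≟ᶜ u′))

open import Data.List.Membership.DecPropositional _≟ᶜ_ using (_∈?_)

-- Tilings of arbitrary regions

Region : Set₁
Region = Pred Cell 0ℓ

record Tiles (R : Region) (P : Pred Tile 0ℓ) : Set where
  constructor mkTiles
  field
    inside    : ∀ {t c} → P t → c ∈ₗ cells t → R c
    partition : ∀ {c} → R c → ∃! _≡_ λ t → P t × c ∈ₗ cells t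

  unique : ∀ {c t u} → R c → P t → c ∈ₗ cells t → P u → c ∈ₗ cells u → t ≡ u
  unique Rc Pt c∈t Pu c∈u with partition Rc
  ... | _ , _ , only = trans (sym (only (Pt , c∈t))) (only (Pu , c∈u))

open Tiles

Tiles-resp-≐ : ∀ {R R′ P} → R ≐ R′ → Tiles R P → Tiles R′ P
Tiles-resp-≐ (R⊆R′ , R′⊆R) T = mkTiles (λ Pt c∈t → R⊆R′ (inside T Pt c∈t)) (partition T ∘ R′⊆R)

-- A set of tiles is an arbitrary predicate, so it can match a list only up to `≐`. Distinctness is
-- meant in the same sense: two orderings of one tiling cannot both occur.
record Enumerates (Q : Pred Tile 0ℓ → Set) (ls : List (List Tile)) : Set₁ where
  constructor mkEnumerates
  field
    sound    : All (λ l → Q (_∈ₗ l)) ls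
    complete : ∀ {P} → Q P → Any (λ l → P ≐ (_∈ₗ l)) ls
    distinct : AllPairs (λ l l′ → ¬ (_∈ₗ l) ≐ (_∈ₗ l′)) ls

open Enumerates

enumerates-resp : ∀ {Q Q′ ls} → (∀ {P} → Q P → Q′ P) → (∀ {P} → Q′ P → Q P) →
                  Enumerates Q ls → Enumerates Q′ ls
enumerates-resp Q⇒Q′ Q′⇒Q E =
  mkEnumerates (All.map Q⇒Q′ (sound E)) (complete E ∘ Q′⇒Q) (distinct E)

enumerates-[] : ∀ {Q} → (∀ {P} → ¬ Q P) → Enumerates Q []
enumerates-[] ¬Q = mkEnumerates [] (⊥-elim ∘ ¬Q) []

enumerates-++ : ∀ {Q Q′ ls ls′} → (∀ {P P′} → Q P → Q′ P′ → ¬ P ≐ P′) →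
                Enumerates Q ls → Enumerates Q′ ls′ →
                Enumerates (λ P → Q P ⊎ Q′ P) (ls ++ ls′)
enumerates-++ {ls = ls} disjoint E E′ = mkEnumerates
  (All.++⁺ (All.map inj₁ (sound E)) (All.map inj₂ (sound E′)))
  (λ { (inj₁ q) → Any.++⁺ˡ (complete E q) ; (inj₂ q) → Any.++⁺ʳ ls (complete E′ q) })
  (AllPairs.++⁺ (distinct E) (distinct E′)
    (All.map (λ q → All.map (disjoint q) (sound E′)) (sound E)))

lookup-injective : ∀ {a ℓ} {A : Set a} {_~_ : Rel A ℓ} → Symmetric _~_ → ∀ {xs} →
                   AllPairs (λ x y → ¬ x ~ y) xs → ∀ i j → lookup xs i ~ lookup xs j → i ≡ j
lookup-injective ~-sym (_ ∷ _)  zero    zero    _   = refl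
lookup-injective ~-sym (≁ ∷ _)  zero    (suc j) i~j = ⊥-elim (All.lookup ≁ (∈-lookup j) i~j)
lookup-injective ~-sym (≁ ∷ _)  (suc i) zero    i~j = ⊥-elim (All.lookup ≁ (∈-lookup i) (~-sym i~j))
lookup-injective ~-sym (_ ∷ ≁s) (suc i) (suc j) i~j = cong suc (lookup-injective ~-sym ≁s i j i~j)

-- `complete` gives every tiling a position in `ls`, and `distinct` makes that position depend only
-- on the set of tiles.
enumeration⇒cardinality : ∀ {k n ls} → Enumerates (Tiles (Board k n)) ls →
                          HasCardinality (tilings k n) (length ls)
enumeration⇒cardinality {k} {n} {ls} E = record
  { to        = λ i → tiling (All.lookup (sound E) (∈-lookup i))
  ; from      = index
  ; to-cong   = λ { refl → ≐-refl }
  ; from-cong = λ {T} {T′} T≐T′ → lookup-≐-injective _ _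
      (≐-trans (≐-sym (≐-lookup T)) (≐-trans T≐T′ (≐-lookup T′)))
  ; inverse   = (λ { {T} refl → ≐-sym (≐-lookup T) })
              , (λ {i} {T} T≐i → lookup-≐-injective _ _ (≐-trans (≐-sym (≐-lookup T)) T≐i))
  }
  where
  tiling : ∀ {l} → Tiles (Board k n) (_∈ₗ l) → Tiling k n
  tiling T = record { inside = inside T ; partition = partition T }

  position : (T : Tiling k n) → Any (λ l → Tiling.tiles T ≐ (_∈ₗ l)) ls
  position T = complete E (mkTiles (Tiling.inside T) (Tiling.partition T))

  index : Tiling k n → Fin (length ls)
  index = Any.index ∘ position

  ≐-lookup : (T : Tiling k n) → Tiling.tiles T ≐ (_∈ₗ lookup ls (index T))
  ≐-lookup T = Any.lookup-index (position T)

  lookup-≐-injective = lookup-injective ≐-sym (distinct E)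

_∖_ : Region → Tile → Region
(R ∖ t) c = R c × ¬ c ∈ₗ cells t

Containing : Region → Tile → Pred Tile 0ℓ → Set
Containing R t P = Tiles R P × P t

nonempty : ∀ t → ∃ λ c → c ∈ₗ cells t
nonempty (L₁ at _) = _ , here refl
nonempty (L₂ at _) = _ , here refl
nonempty (L₃ at _) = _ , here refl
nonempty (L₄ at _) = _ , here refl

-- Every tile has a cell, and those of `t` are outside the region. This allows `t` to be cancelled
-- when `t ∷ l` and `t ∷ l′` are compared as sets.
∖-omits : ∀ {R t P} → Tiles (R ∖ t) P → ¬ P t
∖-omits {t = t} T Pt = let _ , c∈t = nonempty t in proj₂ (inside T Pt c∈t) c∈t

module _ {R : Region} {t : Tile} where

  remove : ∀ {P} → Containing R t P → Tiles (R ∖ t) (λ u → P u × u ≢ t)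
  remove {P} (T , Pt) = mkTiles
    (λ (Pu , u≢t) c∈u → inside T Pu c∈u ,
      λ c∈t → u≢t (unique T (inside T Pu c∈u) Pu c∈u Pt c∈t))
    λ (Rc , c∉t) → let u , (Pu , c∈u) , only = partition T Rc in
      u , ((Pu , λ u≡t → c∉t (subst (λ v → _ ∈ₗ cells v) u≡t c∈u)) , c∈u) , λ ((Pv , _) , c∈v) → only (Pv , c∈v)

  insert : ∀ {l} → (∀ {c} → c ∈ₗ cells t → R c) → Tiles (R ∖ t) (_∈ₗ l) → Containing R t (_∈ₗ t ∷ l)
  insert {l} t⊆R T = mkTiles in′ part , here refl
    where
    in′ : ∀ {u c} → u ∈ₗ t ∷ l → c ∈ₗ cells u → R c
    in′ (here refl) c∈u = t⊆R c∈u
    in′ (there u∈l) c∈u = proj₁ (inside T u∈l c∈u)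

    part : ∀ {c} → R c → ∃! _≡_ λ u → u ∈ₗ t ∷ l × c ∈ₗ cells u
    part {c} Rc with c ∈? cells t
    ... | yes c∈t = t , (here refl , c∈t) , λ
      { (here refl , _)    → refl
      ; (there u∈l , c∈u) → ⊥-elim (proj₂ (inside T u∈l c∈u) c∈t) }
    ... | no c∉t = let u , (u∈l , c∈u) , only = partition T (Rc , c∉t) in
      u , (there u∈l , c∈u) , λ
      { (here refl , c∈t) → ⊥-elim (c∉t c∈t)
      ; (there v∈l , c∈v) → only (v∈l , c∈v) }

  -- Removing `t` and putting it back are inverse up to `≐`; decidable equality of tiles separates
  -- `t` from the rest.
  enumerates-containing : ∀ {ls} → (∀ {c} → c ∈ₗ cells t → R c) →
                          Enumerates (Tiles (R ∖ t)) ls → Enumerates (Containing R t) (map (t ∷_) ls)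
  enumerates-containing t⊆R E = mkEnumerates
    (All.map⁺ (All.map (insert t⊆R) (sound E)))
    (λ {P} C → Any.map⁺ (Any.map (restore (proj₂ C)) (complete E (remove C))))
    (AllPairs.map⁺ (distinct-tails (sound E) (distinct E)))
    where
    restore : ∀ {P l} → P t → (λ u → P u × u ≢ t) ≐ (_∈ₗ l) → P ≐ (_∈ₗ t ∷ l)
    restore {P} {l} Pt (⊆l , l⊆) = to , λ { (here refl) → Pt ; (there u∈l) → proj₁ (l⊆ u∈l) }
      where
      to : ∀ {u} → P u → u ∈ₗ t ∷ l
      to {u} Pu with u ≟ᵗ t
      ... | yes refl = here refl
      ... | no  u≢t  = there (⊆l (Pu , u≢t))

    ⊆-tail : ∀ {l l′} → ¬ t ∈ₗ l → (∀ {u} → u ∈ₗ t ∷ l → u ∈ₗ t ∷ l′) → ∀ {u} → u ∈ₗ l → u ∈ₗ l′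
    ⊆-tail t∉l sub u∈l with sub (there u∈l)
    ... | here refl   = ⊥-elim (t∉l u∈l)
    ... | there u∈l′ = u∈l′

    distinct-tails : ∀ {ls} → All (λ l → Tiles (R ∖ t) (_∈ₗ l)) ls →
                     AllPairs (λ l l′ → ¬ (_∈ₗ l) ≐ (_∈ₗ l′)) ls →
                     AllPairs (λ l l′ → ¬ (_∈ₗ t ∷ l) ≐ (_∈ₗ t ∷ l′)) ls
    distinct-tails []       []       = []
    distinct-tails (T ∷ Ts) (≁ ∷ ≁s) =
      All.zipWith (λ (l≁l′ , T′) (sub , sup) →
        l≁l′ (⊆-tail (∖-omits T) sub , ⊆-tail (∖-omits T′) sup)) (≁ , Ts)
      ∷ distinct-tails Ts ≁s

-- All the tiles `tile a` cover `c`, which a tiling covers only once. Hence no tiling contains two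
-- of them, and the lists for different `a` have no tiling in common.
enumerates-concatMap : ∀ {A : Set} {R c} {tile : A → Tile} {f} → R c →
                       (∀ a → c ∈ₗ cells (tile a)) →
                       (∀ a → Enumerates (Containing R (tile a)) (f a)) →
                       ∀ {as} → AllPairs (λ a b → tile a ≢ tile b) as →
                       Enumerates (λ P → Tiles R P × Any (P ∘ tile) as) (concatMap f as)
enumerates-concatMap _ _ _ [] = enumerates-[] λ ()
enumerates-concatMap {R = R} {tile = tile} Rc c∈ E {a ∷ as} (≢s ∷ as!) = enumerates-resp
  (λ { (inj₁ (T , Pa)) → T , here Pa ; (inj₂ (T , Pas)) → T , there Pas })
  (λ { (T , here Pa) → inj₁ (T , Pa) ; (T , there Pas) → inj₂ (T , Pas) })
  (enumerates-++ exclusive (E a) (enumerates-concatMap Rc c∈ E as!))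
  where
  exclusive : ∀ {P P′} → Containing R (tile a) P → Tiles R P′ × Any (P′ ∘ tile) as → ¬ P ≐ P′
  exclusive (_ , Pa) (T′ , P′as) (P⊆P′ , _) =
    let a≢b , P′b = All.lookupAny ≢s P′as in
    a≢b (unique T′ Rc (P⊆P′ Pa) (c∈ a) P′b (c∈ _))

-- The order of the cells and masks

-- The number of column changes (0 or 1) and the row of the next cell.
step : Fin 6 → ℕ × Fin 6
step 0F = 0 , 1F
step 1F = 0 , 2F
step 2F = 0 , 3F
step 3F = 0 , 4F
step 4F = 0 , 5F
step 5F = 1 , 0F

columns : Fin 6 → ℕ
columns = proj₁ ∘ step

next : Fin 6 → Fin 6
next = proj₂ ∘ step

advance : ℕ → Fin 6 → ℕ × Fin 6
advance zero    y = 0 , y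
advance (suc i) y = let d , z = advance i (next y) in columns y + d , z

rank : ℕ × Fin 6 → ℕ
rank (d , y) = d * 6 + toℕ y

rank-step : ∀ y → rank (step y) ≡ suc (toℕ y)
rank-step 0F = refl
rank-step 1F = refl
rank-step 2F = refl
rank-step 3F = refl
rank-step 4F = refl
rank-step 5F = refl

-- Every step raises the rank by one, a column change counting 6. The rank therefore recovers the
-- number of steps, which yields `cellAt-injective`.
rank-advance : ∀ i y → rank (advance i y) ≡ i + toℕ y
rank-advance zero    y = refl
rank-advance (suc i) y = begin
  (columns y + d) * 6 + toℕ z    ≡⟨ cong (λ w → w + toℕ z) (ℕ.*-distribʳ-+ 6 (columns y) d) ⟩
  columns y * 6 + d * 6 + toℕ z  ≡⟨ ℕ.+-assoc (columns y * 6) (d * 6) (toℕ z) ⟩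
  columns y * 6 + rank (d , z)   ≡⟨ cong (λ w → columns y * 6 + w) (rank-advance i (next y)) ⟩
  columns y * 6 + (i + toℕ (next y))   ≡⟨ cong (λ w → columns y * 6 + w) (ℕ.+-comm i _) ⟩
  columns y * 6 + (toℕ (next y) + i)   ≡⟨ ℕ.+-assoc (columns y * 6) _ i ⟨
  rank (step y) + i              ≡⟨ cong (λ w → w + i) (rank-step y) ⟩
  suc (toℕ y) + i                ≡⟨ cong suc (ℕ.+-comm (toℕ y) i) ⟩
  suc i + toℕ y                  ∎
  where
  open ≡-Reasoning
  d = proj₁ (advance i (next y))
  z = proj₂ (advance i (next y))

-- Six steps from row 0 compute to row 0 of the next column, so induction on `X` suffices.
advance-rank : ∀ X (Y : Fin 6) → advance (X * 6 + toℕ Y) 0F ≡ (X , Y)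
advance-rank zero 0F = refl
advance-rank zero 1F = refl
advance-rank zero 2F = refl
advance-rank zero 3F = refl
advance-rank zero 4F = refl
advance-rank zero 5F = refl
advance-rank (suc X) Y = cong (λ (d , z) → suc d , z) (advance-rank X Y)

cellAt : ℕ → Fin 6 → ℕ → Cell
cellAt x y i = let d , z = advance i y in + (x + d) , + toℕ z

cellAt-suc : ∀ x y i → cellAt x y (suc i) ≡ cellAt (x + columns y) (next y) i
cellAt-suc x y i = cong (λ w → + w , + toℕ (proj₂ (advance i (next y)))) (sym (ℕ.+-assoc x (columns y) _))

cellAt-injective : ∀ {x y i j} → cellAt x y i ≡ cellAt x y j → i ≡ j
cellAt-injective {x} {y} {i} {j} eq = ℕ.+-cancelʳ-≡ (toℕ y) i j (begin
  i + toℕ y           ≡⟨ rank-advance i y ⟨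
  rank (advance i y)  ≡⟨ cong₂ (λ d z → d * 6 + z)
                          (ℕ.+-cancelˡ-≡ x _ _ (ℤ.+-injective (,-injectiveˡ eq)))
                          (ℤ.+-injective (,-injectiveʳ eq)) ⟩
  rank (advance j y)  ≡⟨ rank-advance j y ⟩
  j + toℕ y           ∎)
  where open ≡-Reasoning

-- Bit i tells whether the i-th cell from the current one is already covered;
-- bits beyond the end of the list are false.
Mask : Set
Mask = List Bool

bit : Mask → ℕ → Bool
bit []      _       = false
bit (b ∷ _) zero    = b
bit (_ ∷ m) (suc i) = bit m i

Occupied : Mask → ℕ → Set
Occupied m i = T (bit m i)

shift : Mask → Mask
shift = drop 1

bit-shift : ∀ m i → bit (shift m) i ≡ bit m (suc i)
bit-shift []      _ = refl
bit-shift (_ ∷ _) _ = refl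

-- A short mask is padded with `false` only up to the new `true`. Masks that grow from `[]` thus
-- never end in `false`, and are equal as lists when they have the same occupied positions.
mark : ℕ → Mask → Mask
mark zero    m = true ∷ shift m
mark (suc i) m = bit m 0 ∷ mark i (shift m)

occupied-mark⁺ : ∀ i {m j} → j ≡ i ⊎ Occupied m j → Occupied (mark i m) j
occupied-mark⁺ zero    {m} {zero}  _            = _
occupied-mark⁺ zero    {m} {suc j} (inj₂ o)     = subst T (sym (bit-shift m j)) o
occupied-mark⁺ (suc i) {[]}    {zero}  (inj₂ o) = o
occupied-mark⁺ (suc i) {b ∷ m} {zero}  (inj₂ o) = o
occupied-mark⁺ (suc i) {m} {suc j} (inj₁ refl)  = occupied-mark⁺ i (inj₁ refl)
occupied-mark⁺ (suc i) {m} {suc j} (inj₂ o)     =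
  occupied-mark⁺ i (inj₂ (subst T (sym (bit-shift m j)) o))

occupied-mark⁻ : ∀ i {m j} → Occupied (mark i m) j → j ≡ i ⊎ Occupied m j
occupied-mark⁻ zero    {m} {zero}  _ = inj₁ refl
occupied-mark⁻ zero    {m} {suc j} o = inj₂ (subst T (bit-shift m j) o)
occupied-mark⁻ (suc i) {b ∷ m} {zero}  o = inj₂ o
occupied-mark⁻ (suc i) {m} {suc j} o with occupied-mark⁻ i {shift m} o
... | inj₁ refl = inj₁ refl
... | inj₂ o′   = inj₂ (subst T (bit-shift m j) o′)

marks : List ℕ → Mask → Mask
marks is m = foldr mark m is

occupied-marks⁺ : ∀ is m {j} → j ∈ₗ is ⊎ Occupied m j → Occupied (marks is m) j
occupied-marks⁺ []       m (inj₂ o)           = o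
occupied-marks⁺ (i ∷ is) m (inj₁ (here eq))   = occupied-mark⁺ i (inj₁ eq)
occupied-marks⁺ (i ∷ is) m (inj₁ (there j∈))  = occupied-mark⁺ i (inj₂ (occupied-marks⁺ is m (inj₁ j∈)))
occupied-marks⁺ (i ∷ is) m (inj₂ o)           = occupied-mark⁺ i (inj₂ (occupied-marks⁺ is m (inj₂ o)))

occupied-marks⁻ : ∀ is m {j} → Occupied (marks is m) j → j ∈ₗ is ⊎ Occupied m j
occupied-marks⁻ []       m o = inj₂ o
occupied-marks⁻ (i ∷ is) m o with occupied-mark⁻ i o
... | inj₁ eq = inj₁ (here eq)
... | inj₂ o′ = Sum.map₁ there (occupied-marks⁻ is m o′)

Free : ℕ → Fin 6 → Mask → ℕ → Region
Free x y m N c = ∃ λ i → i < N × ¬ Occupied m i × c ≡ cellAt x y i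

board-free : ∀ n → Free 0 0F [] (n * 6) ≐ Board 6 n
board-free n = to , from
  where
  to : ∀ {c} → Free 0 0F [] (n * 6) c → Board 6 n c
  to (i , i<N , _ , refl) =
    (+≤+ z≤n , +<+ (ℕ.*-cancelʳ-< 6 _ n (ℕ.≤-<-trans (ℕ.m≤m+n _ _)
      (subst (_< n * 6) (sym (trans (rank-advance i 0F) (ℕ.+-identityʳ i))) i<N)))) ,
    (+≤+ z≤n , +<+ (Fin.toℕ<n _))

  from : ∀ {c} → Board 6 n c → Free 0 0F [] (n * 6) c
  from {+ X , + Y} ((_ , +<+ X<n) , (_ , +<+ Y<6)) =
    X * 6 + Y , bound , (λ ()) , eq
    where
    bound : X * 6 + Y < n * 6
    bound = ℕ.<-≤-trans (ℕ.+-monoʳ-< (X * 6) Y<6)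
              (subst (_≤ n * 6) (ℕ.+-comm 6 (X * 6)) (ℕ.*-monoˡ-≤ 6 X<n))

    eq : (+ X , + Y) ≡ cellAt 0 0F (X * 6 + Y)
    eq = subst (λ Y → (+ X , + Y) ≡ cellAt 0 0F (X * 6 + Y)) (Fin.toℕ-fromℕ< Y<6)
           (sym (cong (λ (d , z) → + d , + toℕ z) (advance-rank X (fromℕ< Y<6))))

free-shift : ∀ {x y} m {N} → Occupied m 0 → Free x y m (suc N) ≐ Free (x + columns y) (next y) (shift m) N
free-shift {x} {y} m {N} o = to , from
  where
  to : ∀ {c} → Free x y m (suc N) c → Free (x + columns y) (next y) (shift m) N c
  to (zero  , _   , ¬o , _)    = ⊥-elim (¬o o)
  to (suc i , i<N , ¬o , refl) =
    i , s<s⁻¹ i<N , ¬o ∘ subst T (bit-shift m i) , cellAt-suc x y i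

  from : ∀ {c} → Free (x + columns y) (next y) (shift m) N c → Free x y m (suc N) c
  from (i , i<N , ¬o , refl) =
    suc i , s<s i<N , ¬o ∘ subst T (sym (bit-shift m i)) , sym (cellAt-suc x y i)

free-∖ : ∀ {x y m N t is} → cells t ≡ map (cellAt x y) is → Free x y m N ∖ t ≐ Free x y (marks is m) N
free-∖ {x} {y} {m} {N} {t} {is} eq = to , from
  where
  to : ∀ {c} → (Free x y m N ∖ t) c → Free x y (marks is m) N c
  to ((i , i<N , ¬o , refl) , c∉t) = i , i<N , fresh ∘ occupied-marks⁻ is m , refl
    where
    fresh : ¬ (i ∈ₗ is ⊎ Occupied m i)
    fresh (inj₁ i∈) = c∉t (subst (cellAt x y i ∈ₗ_) (sym eq) (∈-map⁺ (cellAt x y) i∈))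
    fresh (inj₂ o)  = ¬o o

  from : ∀ {c} → Free x y (marks is m) N c → (Free x y m N ∖ t) c
  from (i , i<N , ¬o , refl) =
    (i , i<N , ¬o ∘ occupied-marks⁺ is m ∘ inj₂ , refl) , λ c∈t →
    let j , j∈ , eq′ = ∈-map⁻ (cellAt x y) (subst (cellAt x y i ∈ₗ_) eq c∈t) in
    ¬o (occupied-marks⁺ is m (inj₁ (subst (_∈ₗ is) (sym (cellAt-injective {x} {y} {i} {j} eq′)) j∈)))

-- The tile with a given first cell

-- The row of the lowest cell in column 0 of the footprint, which the scan meets first. Column 0 of
-- `L₄` holds only the cell in row 2.
height : Shape → ℤ
height L₁ = + 0
height L₂ = + 0
height L₃ = + 0
height L₄ = + 2

anchor : Shape → Cell
anchor s = + 0 , height s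

tileAt : ℕ → Fin 6 → Shape → Tile
tileAt x y s = s at (+ x , + toℕ y ℤ.- height s)

-- The positions, in the scanning order, of the cells of a tile relative to
-- its anchor: 6 per column and 1 per row.
offsets : Shape → List ℕ
offsets L₁ = 0 ∷ 1 ∷ 2 ∷ 6 ∷ []
offsets L₂ = 0 ∷ 1 ∷ 7 ∷ 13 ∷ []
offsets L₃ = 0 ∷ 6 ∷ 12 ∷ 13 ∷ []
offsets L₄ = 0 ∷ 4 ∷ 5 ∷ 6 ∷ []

-- Unlike `Free` this ignores the mask and the end of the board, so that fitting depends on the row
-- and the shape alone.
Reachable : ℕ → Fin 6 → Region
Reachable x y c = ∃ λ i → c ≡ cellAt x y i

data Fit (y : Fin 6) (s : Shape) : Bool → Set where
  fit   : (∀ x → cells (tileAt x y s) ≡ map (cellAt x y) (offsets s)) → Fit y s true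
  unfit : (∀ x → ¬ (∀ {c} → c ∈ₗ cells (tileAt x y s) → Reachable x y c)) → Fit y s false

fits : Fin 6 → Shape → Bool
fits 4F L₁ = false
fits 5F L₁ = false
fits 5F L₂ = false
fits 5F L₃ = false
fits 0F L₄ = false
fits 1F L₄ = false
fits _  _  = true

-- A tile that does not fit has a cell in row 6 or in a negative row.
row≢6 : ∀ {x y d} → ¬ Reachable x y (d , + 6)
row≢6 {y = y} (i , eq) = ℕ.<⇒≢ (Fin.toℕ<n (proj₂ (advance i y))) (sym (ℤ.+-injective (,-injectiveʳ eq)))

row≢-1+ : ∀ {x y d e} → ¬ Reachable x y (d , -[1+ e ])
row≢-1+ (i , ())

-- For concrete `y` and `s` both lists of cells have the same normal form even with `x` a variable,
-- hence `refl`.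
fits? : ∀ y s → Fit y s (fits y s)
fits? 0F L₁ = fit λ _ → refl
fits? 1F L₁ = fit λ _ → refl
fits? 2F L₁ = fit λ _ → refl
fits? 3F L₁ = fit λ _ → refl
fits? 4F L₁ = unfit λ x sub → row≢6 (sub (there (there (here refl))))
fits? 5F L₁ = unfit λ x sub → row≢6 (sub (there (here refl)))
fits? 0F L₂ = fit λ _ → refl
fits? 1F L₂ = fit λ _ → refl
fits? 2F L₂ = fit λ _ → refl
fits? 3F L₂ = fit λ _ → refl
fits? 4F L₂ = fit λ _ → refl
fits? 5F L₂ = unfit λ x sub → row≢6 (sub (there (here refl)))
fits? 0F L₃ = fit λ _ → refl
fits? 1F L₃ = fit λ _ → refl
fits? 2F L₃ = fit λ _ → refl
fits? 3F L₃ = fit λ _ → refl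
fits? 4F L₃ = fit λ _ → refl
fits? 5F L₃ = unfit λ x sub → row≢6 (sub (there (there (there (here refl)))))
fits? 0F L₄ = unfit λ x sub → row≢-1+ (sub (there (here refl)))
fits? 1F L₄ = unfit λ x sub → row≢-1+ (sub (there (here refl)))
fits? 2F L₄ = fit λ _ → refl
fits? 3F L₄ = fit λ _ → refl
fits? 4F L₄ = fit λ _ → refl
fits? 5F L₄ = fit λ _ → refl

-- The scanning order as a lexicographic order, columns first. In this form it makes sense on all of
-- the plane and is compatible with translations.
_≼_ : Cell → Cell → Set
(f₁ , f₂) ≼ (g₁ , g₂) = f₁ ℤ.≤ g₁ × (f₁ ≡ g₁ → f₂ ℤ.≤ g₂)

anchor∈ : ∀ s → anchor s ∈ₗ footprint s
anchor∈ L₁ = here refl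
anchor∈ L₂ = here refl
anchor∈ L₃ = here refl
anchor∈ L₄ = here refl

anchor-first : ∀ s {f} → f ∈ₗ footprint s → f ≼ anchor s → f ≡ anchor s
anchor-first L₁ (here refl)                         _ = refl
anchor-first L₁ (there (here refl))                 (_ , p) with p refl
... | +≤+ ()
anchor-first L₁ (there (there (here refl)))         (_ , p) with p refl
... | +≤+ ()
anchor-first L₁ (there (there (there (here refl)))) (+≤+ () , _)
anchor-first L₂ (here refl)                         _ = refl
anchor-first L₂ (there (here refl))                 (_ , p) with p refl
... | +≤+ ()
anchor-first L₂ (there (there (here refl)))         (+≤+ () , _)
anchor-first L₂ (there (there (there (here refl)))) (+≤+ () , _)
anchor-first L₃ (here refl)                         _ = refl
anchor-first L₃ (there (here refl))                 (+≤+ () , _)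
anchor-first L₃ (there (there (here refl)))         (+≤+ () , _)
anchor-first L₃ (there (there (there (here refl)))) (+≤+ () , _)
anchor-first L₄ (here refl)                         _ = refl
anchor-first L₄ (there (here refl))                 (+≤+ () , _)
anchor-first L₄ (there (there (here refl)))         (+≤+ () , _)
anchor-first L₄ (there (there (there (here refl)))) (+≤+ () , _)

+-cancelˡ-≤ : ∀ u {i j} → u ℤ.+ i ℤ.≤ u ℤ.+ j → i ℤ.≤ j
+-cancelˡ-≤ u {i} {j} = subst₂ ℤ._≤_ (\\-leftDividesʳ u i) (\\-leftDividesʳ u j) ∘ ℤ.+-monoʳ-≤ (ℤ.- u)

≼-translate⁻ : ∀ v {f g} → translate v f ≼ translate v g → f ≼ g
≼-translate⁻ (u , v) (p , q) = +-cancelˡ-≤ u p , +-cancelˡ-≤ v ∘ q ∘ cong (λ w → u ℤ.+ w)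

cellAt-first : ∀ x y i → cellAt x y 0 ≼ cellAt x y i
cellAt-first x y i = +≤+ (ℕ.+-monoʳ-≤ x z≤n) , λ eq → +≤+ (row (ℕ.+-cancelˡ-≡ x _ _ (ℤ.+-injective eq)))
  where
  row : 0 ≡ proj₁ (advance i y) → toℕ y ≤ toℕ (proj₂ (advance i y))
  row eq with advance i y | rank-advance i y
  -- With no column change the rank is the row, so `r` reads `toℕ z ≡ i + toℕ y`.
  row refl | _ , z | r = subst (toℕ y ≤_) (sym r) (ℕ.m≤n+m (toℕ y) i)

-- The anchor of `t` is reachable, so it does not precede the current cell. But it is the first cell
-- of `t`, which covers the current cell; so the two coincide, and this determines the offset.
anchored : ∀ {x y} t → cellAt x y 0 ∈ₗ cells t → (∀ {c} → c ∈ₗ cells t → Reachable x y c) →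
           ∃ λ s → t ≡ tileAt x y s
anchored {x} {y} (s at v) c∈t sub with ∈-map⁻ (translate v) c∈t
... | f , f∈s , eq with anchor-first s f∈s (≼-translate⁻ v
       (let i , eq′ = sub (∈-map⁺ (translate v) (anchor∈ s)) in subst₂ _≼_ eq (sym eq′) (cellAt-first x y i)))
...   | refl = s , cong (s at_) (cong₂ _,_
                 (trans (sym (ℤ.+-identityʳ _))
                        (trans (sym (,-injectiveˡ eq)) (cong (λ w → + w) (ℕ.+-identityʳ x))))
                 (trans (sym (//-rightDividesʳ (height s) (proj₂ v)))
                        (cong (ℤ._- height s) (sym (,-injectiveʳ eq)))))

cell∈tileAt : ∀ x y s → cellAt x y 0 ∈ₗ cells (tileAt x y s)
cell∈tileAt x y s = subst (_∈ₗ cells (tileAt x y s)) (cong (+ (x + 0) ,_) (//-rightDividesˡ (height s) (+ toℕ y)))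
  (∈-map⁺ (translate (Tile.offset (tileAt x y s))) (anchor∈ s))

-- Enumeration of the tilings

place : Fin 6 → Mask → Shape → Maybe Mask
place y m s = if fits y s ∧ not (any (bit m) (offsets s)) then just (shift (marks (offsets s) m)) else nothing

data Placement (y : Fin 6) (m : Mask) (s : Shape) : Maybe Mask → Set where
  outside : (∀ x → ¬ (∀ {c} → c ∈ₗ cells (tileAt x y s) → Reachable x y c)) → Placement y m s nothing
  blocked : (∀ x → cells (tileAt x y s) ≡ map (cellAt x y) (offsets s)) →
            Any (Occupied m) (offsets s) → Placement y m s nothing
  placed  : (∀ x → cells (tileAt x y s) ≡ map (cellAt x y) (offsets s)) →
            ¬ Any (Occupied m) (offsets s) → Placement y m s (just (shift (marks (offsets s) m)))

place? : ∀ y m s → Placement y m s (place y m s)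
place? y m s with fits y s | fits? y s
... | false | unfit ⊈ = outside ⊈
... | true  | fit eq  with any (bit m) (offsets s) in eq′
...   | true  = blocked eq (Any.any⁻ (bit m) (offsets s) (subst T (sym eq′) _))
...   | false = placed eq λ o → subst T eq′ (Any.any⁺ (bit m) o)

shapes : List Shape
shapes = L₁ ∷ L₂ ∷ L₃ ∷ L₄ ∷ []

shapes-complete : ∀ s → s ∈ₗ shapes
shapes-complete L₁ = here refl
shapes-complete L₂ = there (here refl)
shapes-complete L₃ = there (there (here refl))
shapes-complete L₄ = there (there (there (here refl)))

prepend : Tile → (Mask → List (List Tile)) → Maybe Mask → List (List Tile)
prepend t f = maybe (map (t ∷_) ∘ f) []

enumeration : ℕ → ℕ → Fin 6 → Mask → List (List Tile)
-- A bit that is still set belongs to a cell beyond the end of the region.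
enumeration zero    x y m = if or m then [] else [] ∷ []
enumeration (suc N) x y m =
  if bit m 0 then enumeration N (x + columns y) (next y) (shift m)
  else concatMap (λ s → prepend (tileAt x y s) (enumeration N (x + columns y) (next y)) (place y m s)) shapes

or⁻ : ∀ m → T (or m) → ∃ (Occupied m)
or⁻ (true  ∷ m) _ = 0 , _
or⁻ (false ∷ m) o = let i , o′ = or⁻ m o in suc i , o′

or⁺ : ∀ m i → Occupied m i → T (or m)
or⁺ (true  ∷ m) _       _ = _
or⁺ (false ∷ m) (suc i) o = or⁺ m i o

occupied-shift⁺ : ∀ m i → Occupied m (suc i) → Occupied (shift m) i
occupied-shift⁺ m i = subst T (sym (bit-shift m i))

occupied-shift⁻ : ∀ m i → Occupied (shift m) i → Occupied m (suc i)
occupied-shift⁻ m i = subst T (bit-shift m i)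

concatMap-[] : ∀ {A B : Set} {f : A → List B} → (∀ a → f a ≡ []) → ∀ as → concatMap f as ≡ []
concatMap-[] f≡[] []       = refl
concatMap-[] f≡[] (a ∷ as) = cong₂ _++_ (f≡[] a) (concatMap-[] f≡[] as)

if-elim : ∀ {a p} {A : Set a} (P : A → Set p) b {t e} →
          (T b → P t) → (¬ T b → P e) → P (if b then t else e)
if-elim P true  onTrue _       = onTrue _
if-elim P false _      onFalse = onFalse id

-- Placing a tile does not check that it stays to the left of the end of the
-- board; the bits that it leaves beyond the end exclude any tiling.
enumeration-overhang : ∀ N x y m i → N ≤ i → Occupied m i → enumeration N x y m ≡ []
enumeration-overhang zero x y m i _ o with or m | or⁺ m i o
... | true | _ = refl
enumeration-overhang (suc N) x y m (suc i) (s≤s N≤i) o = if-elim (_≡ []) (bit m 0)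
  (λ _ → enumeration-overhang N _ _ (shift m) i N≤i (occupied-shift⁺ m i o))
  (λ _ → concatMap-[] (λ s → branch s (place? y m s)) shapes)
  where
  branch : ∀ s {p} → Placement y m s p →
           prepend (tileAt x y s) (enumeration N (x + columns y) (next y)) p ≡ []
  branch s (outside _)   = refl
  branch s (blocked _ _) = refl
  branch s (placed _ _)  = cong (map _) (enumeration-overhang N _ _ _ i N≤i
    (occupied-shift⁺ (marks (offsets s) m) i (occupied-marks⁺ (offsets s) m (inj₂ o))))

-- The invariant for correctness: a bit beyond the end leaves `Free` unchanged but empties the
-- enumeration.
Bounded : Mask → ℕ → Set
Bounded m N = ∀ i → Occupied m i → i < N

bounded-shift : ∀ m {N} → Bounded m (suc N) → Bounded (shift m) N
bounded-shift m bd i o = s<s⁻¹ (bd (suc i) (occupied-shift⁻ m i o))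

tileAt-distinct : ∀ x y → AllPairs (λ s s′ → tileAt x y s ≢ tileAt x y s′) shapes
tileAt-distinct x y = ((λ ()) ∷ (λ ()) ∷ (λ ()) ∷ []) ∷ ((λ ()) ∷ (λ ()) ∷ []) ∷ ((λ ()) ∷ []) ∷ [] ∷ []

enumerates-empty : ∀ {R} → (∀ {c} → ¬ R c) → Enumerates (Tiles R) ([] ∷ [])
enumerates-empty ¬R = mkEnumerates
  (mkTiles (λ ()) (λ Rc → ⊥-elim (¬R Rc)) ∷ [])
  (λ T → here ((λ {t} Pt → ⊥-elim (¬R (inside T Pt (proj₂ (nonempty t))))) , λ ()))
  ([] ∷ [])

module _ {x y m N} (¬o : ¬ Occupied m 0)
         (IH : ∀ m′ → Bounded m′ N →
               Enumerates (Tiles (Free (x + columns y) (next y) m′ N)) (enumeration N (x + columns y) (next y) m′))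
         where

  private
    R = Free x y m (suc N)

  0∈offsets : ∀ s → 0 ∈ₗ offsets s
  0∈offsets L₁ = here refl
  0∈offsets L₂ = here refl
  0∈offsets L₃ = here refl
  0∈offsets L₄ = here refl

  free⇒reachable : ∀ {c} → R c → Reachable x y c
  free⇒reachable (i , _ , _ , eq) = i , eq

  enumerates-branch : ∀ s {p} → Placement y m s p → Bounded m (suc N) →
    Enumerates (Containing R (tileAt x y s))
               (prepend (tileAt x y s) (enumeration N (x + columns y) (next y)) p)
  enumerates-branch s (outside ⊈) _ =
    enumerates-[] λ (T , Pt) → ⊈ x (free⇒reachable ∘ inside T Pt)
  -- An occupied offset is a cell of the tile, so it would have to be free.
  enumerates-branch s (blocked eq o) _ = enumerates-[] λ {P} (T , Pt) →
    let i , i∈ , oi = find o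
        j , _ , ¬oj , eq′ = inside T Pt (subst (cellAt x y i ∈ₗ_) (sym (eq x)) (∈-map⁺ (cellAt x y) i∈)) in
    ¬oj (subst (Occupied m) (cellAt-injective {x} {y} {i} {j} eq′) oi)
  enumerates-branch s (placed eq ¬os) bd with All.all? (_<? suc N) (offsets s)
  ... | yes is<N = enumerates-containing t⊆R
          (enumerates-resp (Tiles-resp-≐ (≐-sym R∖t)) (Tiles-resp-≐ R∖t) (IH m′ (bounded-shift m⁺ bd′)))
    where
    m⁺ = marks (offsets s) m
    m′ = shift m⁺

    bd′ : Bounded m⁺ (suc N)
    bd′ i o with occupied-marks⁻ (offsets s) m o
    ... | inj₁ i∈ = All.lookup is<N i∈
    ... | inj₂ o′ = bd i o′

    R∖t : R ∖ tileAt x y s ≐ Free (x + columns y) (next y) m′ N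
    R∖t = ≐-trans (free-∖ {t = tileAt x y s} (eq x)) (free-shift m⁺ (occupied-marks⁺ (offsets s) m (inj₁ (0∈offsets s))))

    t⊆R : ∀ {c} → c ∈ₗ cells (tileAt x y s) → R c
    t⊆R {c} c∈t = let i , i∈ , eq′ = ∈-map⁻ (cellAt x y) (subst (c ∈ₗ_) (eq x) c∈t) in
      i , All.lookup is<N i∈ , (λ o → ¬os (lose i∈ o)) , eq′
  ... | no ¬is<N = let i , i∈ , i≮N = find (All.¬All⇒Any¬ (_<? suc N) _ ¬is<N) in
    overhanging i i∈ (ℕ.≮⇒≥ i≮N)
    where
    m⁺ = marks (offsets s) m

    -- Both sides are empty: the tile leaves the region, and its bit beyond the end kills the rest
    -- of the enumeration.
    overhanging : ∀ i → i ∈ₗ offsets s → suc N ≤ i → Enumerates (Containing R (tileAt x y s))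
                    (map (tileAt x y s ∷_) (enumeration N (x + columns y) (next y) (shift m⁺)))
    overhanging (suc i) i∈ (s≤s N≤i) = subst (Enumerates _)
      (sym (cong (map _) (enumeration-overhang N _ _ _ i N≤i
        (occupied-shift⁺ m⁺ i (occupied-marks⁺ (offsets s) m (inj₁ i∈))))))
      (enumerates-[] λ (T , Pt) →
        let j , j<N , _ , eq′ = inside T Pt (subst (cellAt x y (suc i) ∈ₗ_) (sym (eq x)) (∈-map⁺ (cellAt x y) i∈)) in
        ℕ.<⇒≱ j<N (subst (suc N ≤_) (cellAt-injective {x} {y} {suc i} {j} eq′) (s≤s N≤i)))

-- Induction on the number of cells left to scan. A covered cell is skipped; a free one is covered
-- by exactly one tile, which by `anchored` is one of the four `tileAt x y s`.
enumeration-correct : ∀ N x y m → Bounded m N → Enumerates (Tiles (Free x y m N)) (enumeration N x y m)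
enumeration-correct zero x y m bd = if-elim (Enumerates _) (or m)
  (λ o → let i , oi = or⁻ m o in ⊥-elim (ℕ.n≮0 (bd i oi)))
  (λ _ → enumerates-empty λ ())
enumeration-correct (suc N) x y m bd = if-elim (Enumerates (Tiles R)) (bit m 0) occupied vacant
  where
  R = Free x y m (suc N)
  IH = enumeration-correct N (x + columns y) (next y)

  occupied : Occupied m 0 → Enumerates (Tiles R) (enumeration N (x + columns y) (next y) (shift m))
  occupied o = enumerates-resp (Tiles-resp-≐ (≐-sym (free-shift m o))) (Tiles-resp-≐ (free-shift m o))
                 (IH (shift m) (bounded-shift m bd))

  vacant : ¬ Occupied m 0 → Enumerates (Tiles R) _
  vacant ¬o = enumerates-resp proj₁ (λ T → T , tile-at-corner T)
    (enumerates-concatMap corner∈R (cell∈tileAt x y)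
      (λ s → enumerates-branch {m = m} ¬o IH s (place? y m s) bd)
      (tileAt-distinct x y))
    where
    corner∈R : R (cellAt x y 0)
    corner∈R = 0 , z<s , ¬o , refl

    tile-at-corner : ∀ {P} → Tiles R P → Any (P ∘ tileAt x y) shapes
    tile-at-corner {P} T with partition T corner∈R
    ... | t , (Pt , c∈t) , _ with anchored {x} {y} t c∈t (λ c∈t → let i , _ , _ , eq = inside T Pt c∈t in i , eq)
    ...   | s , refl = lose (shapes-complete s) Pt

-- Counting by a transfer matrix

successors : Fin 6 → Mask → List Mask
successors y m = if bit m 0 then shift m ∷ [] else mapMaybe (place y m) shapes

-- The column is gone, because `place` does not depend on it.
count : ℕ → Fin 6 → Mask → ℕ
count zero    y m = if or m then 0 else 1
count (suc N) y m = sum (map (count N (next y)) (successors y m))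

length-enumeration : ∀ N x y m → length (enumeration N x y m) ≡ count N y m
length-enumeration zero    x y m with or m
... | true  = refl
... | false = refl
length-enumeration (suc N) x y m =
  choose (bit m 0) (trans (length-enumeration N _ _ _) (sym (ℕ.+-identityʳ _))) (branches shapes)
  where
  choose : ∀ b {ls ls′ : List (List Tile)} {ms ms′} → length ls ≡ sum (map (count N (next y)) ms) →
           length ls′ ≡ sum (map (count N (next y)) ms′) →
           length (if b then ls else ls′) ≡ sum (map (count N (next y)) (if b then ms else ms′))
  choose true  eq _ = eq
  choose false _ eq = eq

  branches : ∀ ss →
    length (concatMap (λ s → prepend (tileAt x y s) (enumeration N (x + columns y) (next y)) (place y m s)) ss) ≡
    sum (map (count N (next y)) (mapMaybe (place y m) ss))
  branches []       = refl
  branches (s ∷ ss) with place y m s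
  ... | nothing = branches ss
  ... | just m′ = trans (List.length-++ (map _ (enumeration N _ _ m′)))
    (cong₂ _+_ (trans (List.length-map _ (enumeration N _ _ m′)) (length-enumeration N _ _ m′)) (branches ss))

-- Repetitions are kept: the multiplicities are the entries of the transfer matrix.
ends : ℕ → Fin 6 → Mask → List Mask
ends zero    y m = m ∷ []
ends (suc k) y m = concatMap (ends k (next y)) (successors y m)

rowAfter : ℕ → Fin 6 → Fin 6
rowAfter zero    y = y
rowAfter (suc k) y = rowAfter k (next y)

sum-concatMap : ∀ {A B : Set} (f : B → ℕ) (g : A → List B) as →
                sum (map f (concatMap g as)) ≡ sum (map (sum ∘ map f ∘ g) as)
sum-concatMap f g []       = refl
sum-concatMap f g (a ∷ as) = begin
  sum (map f (g a ++ concatMap g as))               ≡⟨ cong sum (List.map-++ f (g a) _) ⟩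
  sum (map f (g a) ++ map f (concatMap g as))       ≡⟨ sum-++ (map f (g a)) _ ⟩
  sum (map f (g a)) + sum (map f (concatMap g as))  ≡⟨ cong (λ w → sum (map f (g a)) + w) (sum-concatMap f g as) ⟩
  sum (map f (g a)) + sum (map (sum ∘ map f ∘ g) as) ∎
  where open ≡-Reasoning

count-ends : ∀ k N y m → count (k + N) y m ≡ sum (map (count N (rowAfter k y)) (ends k y m))
count-ends zero    N y m = sym (ℕ.+-identityʳ _)
count-ends (suc k) N y m = begin
  sum (map (count (k + N) (next y)) (successors y m))
    ≡⟨ cong sum (List.map-cong (count-ends k N (next y)) (successors y m)) ⟩
  sum (map (sum ∘ map (count N _) ∘ ends k (next y)) (successors y m))
    ≡⟨ sum-concatMap (count N _) (ends k (next y)) (successors y m) ⟨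
  sum (map (count N _) (ends (suc k) y m)) ∎
  where open ≡-Reasoning

-- 24 cells are four columns, after which the scan is again in row 0.
block : Mask → List Mask
block = ends 24 0F

_≟ᵐ_ : DecidableEquality Mask
_≟ᵐ_ = List.≡-dec Bool._≟_

explore : List Mask → List Mask
explore ms = deduplicate _≟ᵐ_ (ms ++ concatMap block ms)

-- Convolutions and linear recurrences

-- Coefficients of the product of a polynomial and a power series.
conv : List ℤ → (ℕ → ℤ) → ℕ → ℤ
conv []       g n       = + 0
conv (b ∷ bs) g zero    = b ℤ.* g 0
conv (b ∷ bs) g (suc n) = b ℤ.* g (suc n) ℤ.+ conv bs g n

-- With at most `suc n` coefficients the sum never gets back to `g 0`, so it only sees the shifted
-- sequence.
conv-suc : ∀ bs g n → length bs ≤ suc n → conv bs g (suc n) ≡ conv bs (g ∘ suc) n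
conv-suc []           g n       _          = refl
conv-suc (b ∷ [])     g zero    _          = ℤ.+-identityʳ _
conv-suc (b ∷ _ ∷ _)  g zero    (s≤s ())
conv-suc (b ∷ bs)     g (suc n) (s≤s le)   = cong (λ w → b ℤ.* g (suc (suc n)) ℤ.+ w) (conv-suc bs g n le)

conv-0 : ∀ bs n → conv bs (λ _ → + 0) n ≡ + 0
conv-0 []       n       = refl
conv-0 (b ∷ bs) zero    = ℤ.*-zeroʳ b
conv-0 (b ∷ bs) (suc n) = cong₂ ℤ._+_ (ℤ.*-zeroʳ b) (conv-0 bs n)

conv-+ : ∀ bs g h n → conv bs (λ k → g k ℤ.+ h k) n ≡ conv bs g n ℤ.+ conv bs h n
conv-+ []       g h n       = refl
conv-+ (b ∷ bs) g h zero    = ℤ.*-distribˡ-+ b (g 0) (h 0)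
conv-+ (b ∷ bs) g h (suc n) = begin
  b ℤ.* (g (suc n) ℤ.+ h (suc n)) ℤ.+ conv bs (λ k → g k ℤ.+ h k) n
    ≡⟨ cong₂ ℤ._+_ (ℤ.*-distribˡ-+ b (g (suc n)) (h (suc n))) (conv-+ bs g h n) ⟩
  (b ℤ.* g (suc n) ℤ.+ b ℤ.* h (suc n)) ℤ.+ (conv bs g n ℤ.+ conv bs h n)
    ≡⟨ interchange (b ℤ.* g (suc n)) (b ℤ.* h (suc n)) (conv bs g n) (conv bs h n) ⟩
  (b ℤ.* g (suc n) ℤ.+ conv bs g n) ℤ.+ (b ℤ.* h (suc n) ℤ.+ conv bs h n) ∎
  where open ≡-Reasoning

conv-cong : ∀ bs {g h} → g ≗ h → conv bs g ≗ conv bs h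
conv-cong []       g≗h n       = refl
conv-cong (b ∷ bs) g≗h zero    = cong (b ℤ.*_) (g≗h 0)
conv-cong (b ∷ bs) g≗h (suc n) = cong₂ (λ u w → b ℤ.* u ℤ.+ w) (g≗h (suc n)) (conv-cong bs g≗h n)

-- By linearity of `conv` in the sequence.
conv-sum-0 : ∀ {J : Set} bs (f : ℕ → J → ℕ) n → (∀ j → conv bs (λ k → + f k j) n ≡ + 0) →
             ∀ js → conv bs (λ k → + sum (map (f k) js)) n ≡ + 0
conv-sum-0 bs f n eq []       = conv-0 bs n
conv-sum-0 bs f n eq (j ∷ js) =
  trans (conv-+ bs (λ k → + f k j) (λ k → + sum (map (f k) js)) n)
        (cong₂ ℤ._+_ (eq j) (conv-sum-0 bs f n eq js))

-- A matrix times a vector. Row `i` of the matrix is the list of its column indices, each repeated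
-- as often as its entry says.
pull : ∀ {k} → Vec (List (Fin k)) k → Vec ℕ k → Vec ℕ k
pull rows ws = Vec.map (sum ∘ map (Vec.lookup ws)) rows

iterates : ∀ {k} → Vec (List (Fin k)) k → Vec ℕ k → ℕ → Vec ℕ k
iterates rows ws zero    = ws
iterates rows ws (suc n) = pull rows (iterates rows ws n)

module _ {k} (rows : Vec (List (Fin k)) k) (ws : Vec ℕ k) where

  private
    entry : ℕ → Fin k → ℕ
    entry n = Vec.lookup (iterates rows ws n)

  entry-suc : ∀ n i → entry (suc n) i ≡ sum (map (entry n) (Vec.lookup rows i))
  entry-suc n i = Vec.lookup-map i (sum ∘ map (entry n)) rows

  -- By `conv-suc` the relation at `suc n + d` concerns the shifted sequence, whose entries are sums
  -- of the unshifted ones by `entry-suc`. These sums mix the entries, so the induction must carry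
  -- all `i` at once.
  recurrence-extends : ∀ bs d → length bs ≤ suc d → (∀ i → conv bs (λ n → + entry n i) d ≡ + 0) →
                       ∀ n i → conv bs (λ n → + entry n i) (n + d) ≡ + 0
  recurrence-extends bs d le base zero    i = base i
  recurrence-extends bs d le base (suc n) i = begin
    conv bs (λ k → + entry k i) (suc n + d)
      ≡⟨ conv-suc bs (λ k → + entry k i) (n + d) (ℕ.≤-trans le (s≤s (ℕ.m≤n+m d n))) ⟩
    conv bs (λ k → + entry (suc k) i) (n + d)
      ≡⟨ conv-cong bs (λ k → cong (λ w → + w) (entry-suc k i)) (n + d) ⟩
    conv bs (λ k → + sum (map (entry k) (Vec.lookup rows i))) (n + d)
      ≡⟨ conv-sum-0 bs entry (n + d) (recurrence-extends bs d le base n) (Vec.lookup rows i) ⟩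
    + 0 ∎
    where open ≡-Reasoning

  module _ (masks : Vec Mask k) (rows-block : Vec.map (map (Vec.lookup masks)) rows ≡ Vec.map block masks)
           (initial : ∀ i → Vec.lookup ws i ≡ count 0 0F (Vec.lookup masks i)) where

    row-block : ∀ i → map (Vec.lookup masks) (Vec.lookup rows i) ≡ block (Vec.lookup masks i)
    row-block i = begin
      map (Vec.lookup masks) (Vec.lookup rows i)            ≡⟨ Vec.lookup-map i (map (Vec.lookup masks)) rows ⟨
      Vec.lookup (Vec.map (map (Vec.lookup masks)) rows) i  ≡⟨ cong (λ v → Vec.lookup v i) rows-block ⟩
      Vec.lookup (Vec.map block masks) i                    ≡⟨ Vec.lookup-map i block masks ⟩
      block (Vec.lookup masks i)                            ∎
      where open ≡-Reasoning

    entry-count : ∀ n i → entry n i ≡ count (n * 24) 0F (Vec.lookup masks i)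
    entry-count zero    i = initial i
    entry-count (suc n) i = begin
      entry (suc n) i
        ≡⟨ entry-suc n i ⟩
      sum (map (entry n) (Vec.lookup rows i))
        ≡⟨ cong sum (List.map-cong (entry-count n) (Vec.lookup rows i)) ⟩
      sum (map (count (n * 24) 0F ∘ Vec.lookup masks) (Vec.lookup rows i))
        ≡⟨ cong sum (List.map-∘ (Vec.lookup rows i)) ⟩
      sum (map (count (n * 24) 0F) (map (Vec.lookup masks) (Vec.lookup rows i)))
        ≡⟨ cong (sum ∘ map (count (n * 24) 0F)) (row-block i) ⟩
      sum (map (count (n * 24) 0F) (block (Vec.lookup masks i)))
        -- `rowAfter 24 0F` computes to `0F`.
        ≡⟨ count-ends 24 (n * 24) 0F (Vec.lookup masks i) ⟨
      count (suc n * 24) 0F (Vec.lookup masks i) ∎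
      where open ≡-Reasoning

-- The transfer matrix of the board with six rows

-- Four rounds exhaust the masks reachable from the empty one; that nothing
-- else is reachable is part of transitions-block.
states : Vec Mask 26
states = Vec.fromList (explore (explore (explore (explore ([] ∷ [])))))

-- The masks after one more block, as positions in states.
transitions : Vec (List (Fin 26)) 26
transitions = Vec.map (map (_mod 26))
  ( (1 ∷ 2 ∷ 0 ∷ 3 ∷ 4 ∷ 5 ∷ 6 ∷ 3 ∷ 0 ∷ 7 ∷ 8 ∷ 9 ∷ 0 ∷ 10 ∷ 11 ∷ 0 ∷ 12 ∷ 0 ∷ [])
  ∷ []
  ∷ (0 ∷ 7 ∷ 8 ∷ 9 ∷ [])
  ∷ (2 ∷ 0 ∷ 3 ∷ 4 ∷ 5 ∷ 6 ∷ 3 ∷ [])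
  ∷ (4 ∷ 2 ∷ 0 ∷ 3 ∷ 4 ∷ 5 ∷ 6 ∷ 3 ∷ [])
  ∷ (5 ∷ 6 ∷ 3 ∷ 13 ∷ 5 ∷ 14 ∷ 5 ∷ 15 ∷ 8 ∷ 16 ∷ 17 ∷ 18 ∷ 14 ∷ 5 ∷ 19 ∷ [])
  ∷ (5 ∷ 6 ∷ 3 ∷ [])
  ∷ (0 ∷ 7 ∷ 8 ∷ 9 ∷ [])
  ∷ (16 ∷ 15 ∷ 8 ∷ 16 ∷ 17 ∷ 18 ∷ 14 ∷ 5 ∷ 19 ∷ 8 ∷ 0 ∷ 7 ∷ 8 ∷ 9 ∷ [])
  ∷ (9 ∷ 0 ∷ 7 ∷ 8 ∷ 9 ∷ [])
  ∷ (1 ∷ 10 ∷ 11 ∷ 0 ∷ [])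
  ∷ (12 ∷ 20 ∷ 21 ∷ [])
  ∷ (12 ∷ 0 ∷ [])
  ∷ (22 ∷ [])
  ∷ (14 ∷ 5 ∷ 15 ∷ 8 ∷ 16 ∷ 17 ∷ 18 ∷ 14 ∷ 5 ∷ 19 ∷ [])
  ∷ []
  ∷ []
  ∷ (15 ∷ 8 ∷ 16 ∷ 17 ∷ 18 ∷ 14 ∷ 5 ∷ 19 ∷ [])
  ∷ []
  ∷ []
  ∷ []
  ∷ (12 ∷ 20 ∷ 21 ∷ 23 ∷ [])
  ∷ []
  ∷ (24 ∷ 25 ∷ [])
  ∷ []
  ∷ (24 ∷ 25 ∷ [])
  ∷ [])

transitions-block : Vec.map (map (Vec.lookup states)) transitions ≡ Vec.map block states
transitions-block = from-yes
  (Vec.≡-dec (List.≡-dec _≟ᵐ_) (Vec.map (map (Vec.lookup states)) transitions) (Vec.map block states))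
-- With no cells left only the empty mask, at position 0, admits a tiling.
start : Vec ℕ 26
start = 1 ∷ Vec.replicate 25 0

a : ℕ → ℕ
a n = Vec.lookup (iterates transitions start n) 0F

a-count : ∀ n → a n ≡ count (n * 24) 0F []
a-count n = entry-count transitions start states transitions-block
  (from-yes (Fin.all? λ i → Vec.lookup start i ℕ.≟ count 0 0F (Vec.lookup states i))) n 0F

-- The recurrence and the numerator

t−1 aCoefficients bCoefficients : List ℤ
t−1 = ℤ.- + 1 ∷ + 1 ∷ []
aCoefficients = ℤ.- + 1 ∷ + 18 ∷ ℤ.- + 123 ∷ + 412 ∷ ℤ.- + 732 ∷ + 714
         ∷ ℤ.- + 386 ∷ + 114 ∷ ℤ.- + 17 ∷ + 1 ∷ []
bCoefficients = + 1 ∷ ℤ.- + 25 ∷ + 251 ∷ ℤ.- + 1330 ∷ + 4138 ∷ ℤ.- + 8001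
         ∷ + 9918 ∷ ℤ.- + 7944 ∷ + 4051 ∷ ℤ.- + 1280 ∷ + 239
         ∷ ℤ.- + 24 ∷ + 1 ∷ []

one : ℕ → ℤ
one zero    = + 1
one (suc _) = + 0

-- 12 is the degree of `B`. The relation at index 12 is evaluated for each of the 26 masks and then
-- extended.
recurrence : ∀ n → conv bCoefficients (+_ ∘ a) (n + 12) ≡ + 0
recurrence n = recurrence-extends transitions start bCoefficients 12 (ℕ.≤-refl {13}) base n 0F
  where
  base : ∀ i → conv bCoefficients (λ k → + Vec.lookup (iterates transitions start k) i) 12 ≡ + 0
  base = from-yes (Fin.all? λ i →
    conv bCoefficients (λ k → + Vec.lookup (iterates transitions start k) i) 12 ℤ.≟ + 0)

numerator : ℕ → ℤ
numerator = conv aCoefficients (conv t−1 (conv t−1 one))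

-- The first 12 coefficients are evaluated. From index 12 on the left side vanishes by `recurrence`,
-- the right side by the degree of `A`.
a-numerator : ∀ n → conv bCoefficients (+_ ∘ a) n ≡ ℤ.- numerator n
a-numerator n with n <? 12
... | yes n<12 = subst Holds (Fin.toℕ-fromℕ< n<12) (initial (fromℕ< n<12))
  where
  Holds : ℕ → Set
  Holds n = conv bCoefficients (+_ ∘ a) n ≡ ℤ.- numerator n

  initial : ∀ (i : Fin 12) → Holds (toℕ i)
  initial = from-yes (Fin.all? {n = 12} λ i → conv bCoefficients (+_ ∘ a) (toℕ i) ℤ.≟ ℤ.- numerator (toℕ i))
... | no n≮12 = begin
  conv bCoefficients (+_ ∘ a) n             ≡⟨ cong (conv bCoefficients (+_ ∘ a)) n∸12+12≡n ⟨
  conv bCoefficients (+_ ∘ a) (n ∸ 12 + 12) ≡⟨ recurrence (n ∸ 12) ⟩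
  ℤ.- + 0                                   ≡⟨⟩
  -- numerator (12 + k) unfolds to + 0, since 12 exceeds the degree of A.
  ℤ.- numerator (12 + (n ∸ 12))             ≡⟨ cong (ℤ.-_ ∘ numerator) (ℕ.+-comm 12 (n ∸ 12)) ⟩
  ℤ.- numerator (n ∸ 12 + 12)               ≡⟨ cong (ℤ.-_ ∘ numerator) n∸12+12≡n ⟩
  ℤ.- numerator n                           ∎
  where
  open ≡-Reasoning
  n∸12+12≡n : n ∸ 12 + 12 ≡ n
  n∸12+12≡n = ℕ.m∸n+n≡m (ℕ.≮⇒≥ n≮12)

-- Power series

fromℤ : ℤ → ℚ
fromℤ i = i ℚ./ 1

-- For a variable `i` the fraction `i ℚ./ 1` is stuck on a gcd. The explicit denominator 1 lets sums
-- and products of rationals unfold to integer ones.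
fromℤ≡mkℚ : ∀ i → fromℤ i ≡ mkℚ i 0 (Coprime.sym (1-coprimeTo ℤ.∣ i ∣))
fromℤ≡mkℚ i = ℚ.fromℚᵘ-toℚᵘ (mkℚ i 0 _)

fromℤ-+ : ∀ i j → fromℤ (i ℤ.+ j) ≡ fromℤ i ℚ.+ fromℤ j
fromℤ-+ i j = trans
  (cong fromℤ (sym (cong₂ ℤ._+_ (ℤ.*-identityʳ i) (ℤ.*-identityʳ j))))
  (sym (cong₂ ℚ._+_ (fromℤ≡mkℚ i) (fromℤ≡mkℚ j)))

fromℤ-* : ∀ i j → fromℤ (i ℤ.* j) ≡ fromℤ i ℚ.* fromℤ j
fromℤ-* i j = sym (cong₂ ℚ._*_ (fromℤ≡mkℚ i) (fromℤ≡mkℚ j))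

fromℤ-neg : ∀ i → fromℤ (ℤ.- i) ≡ ℚ.- fromℤ i
fromℤ-neg (+ zero)  = refl
fromℤ-neg (+ suc n) = refl
fromℤ-neg -[1+ n ]  = sym (ℚ-group.⁻¹-involutive (fromℤ (+ suc n)))

-- Transfers products of series to integer convolutions, for which the finite checks are made.
poly-⊛ : ∀ cs {g P} → P ≗ fromℤ ∘ g → poly cs ⊛ P ≗ fromℤ ∘ conv cs g
poly-⊛ []       {g} {P} P≗g zero    = ℚ.*-zeroˡ (P 0)
poly-⊛ []       {g} {P} P≗g (suc n) = cong₂ ℚ._+_ (ℚ.*-zeroˡ (P (suc n))) (poly-⊛ [] {g} P≗g n)
poly-⊛ (c ∷ cs) {g} {P} P≗g zero    =
  trans (cong (λ p → fromℤ c ℚ.* p) (P≗g 0)) (sym (fromℤ-* c (g 0)))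
poly-⊛ (c ∷ cs) {g} {P} P≗g (suc n) = begin
  fromℤ c ℚ.* P (suc n) ℚ.+ (poly cs ⊛ P) n
    ≡⟨ cong₂ (λ p q → fromℤ c ℚ.* p ℚ.+ q) (P≗g (suc n)) (poly-⊛ cs {g} P≗g n) ⟩
  fromℤ c ℚ.* fromℤ (g (suc n)) ℚ.+ fromℤ (conv cs g n)
    ≡⟨ cong (λ p → p ℚ.+ fromℤ (conv cs g n)) (fromℤ-* c (g (suc n))) ⟨
  fromℤ (c ℤ.* g (suc n)) ℚ.+ fromℤ (conv cs g n)
    ≡⟨ fromℤ-+ (c ℤ.* g (suc n)) (conv cs g n) ⟨
  fromℤ (c ℤ.* g (suc n) ℤ.+ conv cs g n) ∎
  where open ≡-Reasoning

-- Peels the second factor, whereas the definition of `⊛` peels the first; commutativity needs both.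
⊛-suc : ∀ P Q n → (P ⊛ Q) (suc n) ≡ (P ⊛ tail Q) n ℚ.+ P (suc n) ℚ.* Q 0
⊛-suc P Q zero    = refl
⊛-suc P Q (suc n) = trans
  (cong (λ p → P 0 ℚ.* Q (suc (suc n)) ℚ.+ p) (⊛-suc (tail P) Q n))
  (sym (ℚ.+-assoc (P 0 ℚ.* Q (suc (suc n))) ((tail P ⊛ tail Q) n) (P (suc (suc n)) ℚ.* Q 0)))

⊛-comm : ∀ P Q → P ⊛ Q ≗ Q ⊛ P
⊛-comm P Q zero    = ℚ.*-comm (P 0) (Q 0)
⊛-comm P Q (suc n) = begin
  P 0 ℚ.* Q (suc n) ℚ.+ (tail P ⊛ Q) n  ≡⟨ cong₂ ℚ._+_ (ℚ.*-comm (P 0) (Q (suc n))) (⊛-comm (tail P) Q n) ⟩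
  Q (suc n) ℚ.* P 0 ℚ.+ (Q ⊛ tail P) n  ≡⟨ ℚ.+-comm (Q (suc n) ℚ.* P 0) ((Q ⊛ tail P) n) ⟩
  (Q ⊛ tail P) n ℚ.+ Q (suc n) ℚ.* P 0  ≡⟨ ⊛-suc Q P n ⟨
  (Q ⊛ P) (suc n)                       ∎
  where open ≡-Reasoning

-- Follows the long division: constant terms give `R 0`, and subtracting `R 0` times `Q` leaves the
-- same problem for `tail R`.
⊘-unique : ∀ P Q R .{{_ : ℚ.NonZero (Q 0)}} → R ⊛ Q ≗ P → R ≗ P ⊘ Q
⊘-unique P Q R R⊛Q≗P zero = begin
  R 0                               ≡⟨ ℚ.*-identityʳ (R 0) ⟨
  R 0 ℚ.* ℚ.1ℚ                      ≡⟨ cong (λ p → R 0 ℚ.* p) (ℚ.*-inverseʳ (Q 0)) ⟨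
  R 0 ℚ.* (Q 0 ℚ.* ℚ.1/ Q 0)        ≡⟨ ℚ.*-assoc (R 0) (Q 0) (ℚ.1/ Q 0) ⟨
  R 0 ℚ.* Q 0 ℚ.÷ Q 0               ≡⟨ cong (λ p → p ℚ.÷ Q 0) (R⊛Q≗P 0) ⟩
  P 0 ℚ.÷ Q 0                       ∎
  where open ≡-Reasoning
⊘-unique P Q R R⊛Q≗P (suc n) =
  ⊘-unique (tail (P ⊖ scale (P 0 ℚ.÷ Q 0) Q)) Q (tail R) remainder n
  where
  remainder : tail R ⊛ Q ≗ tail (P ⊖ scale (P 0 ℚ.÷ Q 0) Q)
  remainder m = begin
    (tail R ⊛ Q) m
      ≡⟨ ℚ-group.xyx⁻¹≈y (R 0 ℚ.* Q (suc m)) ((tail R ⊛ Q) m) ⟨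
    (R ⊛ Q) (suc m) ℚ.- R 0 ℚ.* Q (suc m)
      ≡⟨ cong₂ (λ p r → p ℚ.- r ℚ.* Q (suc m)) (R⊛Q≗P (suc m)) (⊘-unique P Q R R⊛Q≗P 0) ⟩
    P (suc m) ℚ.- (P 0 ℚ.÷ Q 0) ℚ.* Q (suc m) ∎
    where open ≡-Reasoning

A-numerator : A ≗ fromℤ ∘ numerator
-- `poly-⊛` wants an explicit polynomial as the left factor, so the power of `t−1` is moved to the
-- right.
A-numerator n = trans (⊛-comm (poly t−1 ⊛^ 2) (poly aCoefficients) n)
  (poly-⊛ aCoefficients (poly-⊛ t−1 (poly-⊛ t−1 poly-one)) n)
  where
  poly-one : poly (+ 1 ∷ []) ≗ fromℤ ∘ one
  poly-one zero    = refl
  poly-one (suc _) = refl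

generatingFunction-a : generatingFunction a ≗ (⊝ A) ⊘ B
generatingFunction-a = ⊘-unique (⊝ A) B (generatingFunction a) λ n → begin
  (generatingFunction a ⊛ B) n           ≡⟨ ⊛-comm (generatingFunction a) B n ⟩
  (B ⊛ generatingFunction a) n           ≡⟨ poly-⊛ bCoefficients {+_ ∘ a} (λ _ → refl) n ⟩
  fromℤ (conv bCoefficients (+_ ∘ a) n)  ≡⟨ cong fromℤ (a-numerator n) ⟩
  fromℤ (ℤ.- numerator n)                ≡⟨ fromℤ-neg (numerator n) ⟩
  ℚ.- fromℤ (numerator n)                ≡⟨ cong (λ p → ℚ.- p) (A-numerator n) ⟨
  (⊝ A) n                                ∎
  where open ≡-Reasoning

-- Tilings of the boards with six rows and 4n columns

cardinality : ∀ n → HasCardinality (tilings 6 (4 * n)) (a n)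
cardinality n = subst (HasCardinality (tilings 6 (4 * n)))
  (trans (length-enumeration (n * 24) 0 0F []) (sym (a-count n)))
  (enumeration⇒cardinality (enumerates-resp (Tiles-resp-≐ R≐) (Tiles-resp-≐ (≐-sym R≐))
    (enumeration-correct (n * 24) 0 0F [] λ _ ())))
  where
  R≐ : Free 0 0F [] (n * 24) ≐ Board 6 (4 * n)
  R≐ = subst (λ N → Free 0 0F [] N ≐ Board 6 (4 * n))
         (trans (cong (λ w → w * 6) (ℕ.*-comm 4 n)) (ℕ.*-assoc n 4 6)) (board-free (4 * n))

proposition7 : Σ[ a ∈ (ℕ → ℕ) ] ((∀ (n : ℕ) → HasCardinality (tilings 6 (4 * n)) (a n))
    × (generatingFunction a ≗ (⊝ A) ⊘ B)
    × (map a (upTo 9) ≡ 1 ∷ 5 ∷ 34 ∷ 249 ∷ 1882 ∷ 14492 ∷ 113029 ∷ 889719 ∷ 7050677 ∷ []))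
proposition7 = a , cardinality , generatingFunction-a , refl
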